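{- Let $n\ge0$. Among the elements of $R$ whose binary representation has length $2n+4$, exactly one has binary representation beginning with $1000$, namely $[1000(10)^n]_2$; moreover $[1000(10)^n]_2$ is the smallest element of $R$ whose binary representation has length $2n+4$.
   Context: Stern's sequence $(a(n))_{n\ge0}$: $a(0)=0$, $a(1)=1$, $a(2n)=a(n)$, $a(2n+1)=a(n)+a(n+1)$; $s(n)=a(n+1)$. $R$ is the set of record-setters of $s$, i.e. indices $v\ge0$ with $s(i)<s(v)$ for all $i<v$. Binary representations have no leading zeros. For a binary string $x$, $[x]_2$ is the integer it represents in base 2; $x^i$ denotes $i$-fold concatenation. -}

module Defs where

open import Data.Digit using (Bit; 0b; fromDigits)
open import Data.List.Base using (List; concat; head; length; replicate; reverse)
open import Data.List.Relation.Binary.Prefix.Heterogeneous using (Prefix)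
open import Data.Maybe.Base using (just)
open import Data.Nat.Base using (ℕ; zero; suc; _+_; _*_; _<_; ⌊_/2⌋; ⌈_/2⌉; parity)
open import Data.Nat.Induction using (Acc; acc; <-wellFounded)
open import Data.Nat.Properties using (⌊n/2⌋<n; ⌈n/2⌉<n; +-suc)
open import Data.Parity.Base using (0ℙ; 1ℙ)
open import Data.Product.Base using (_×_; ∃-syntax)
open import Level using (0ℓ)
open import Relation.Binary.PropositionalEquality using (_≡_; _≢_; refl; trans; cong; cong₂)
open import Relation.Unary using (Pred; _∈_)

-- Stern's sequence, by recursion along ⌊n/2⌋ and ⌈n/2⌉; the defining
-- recurrences are a-even and a-odd below.

a-acc : ∀ n → Acc _<_ n → ℕ
a-acc 0             _        = 0
a-acc 1             _        = 1
a-acc (suc (suc m)) (acc rs) with parity m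
... | 0ℙ = a-acc ⌊ suc (suc m) /2⌋ (rs (⌊n/2⌋<n (suc m)))
... | 1ℙ = a-acc ⌊ suc (suc m) /2⌋ (rs (⌊n/2⌋<n (suc m)))
         + a-acc ⌈ suc (suc m) /2⌉ (rs (⌈n/2⌉<n m))

a : ℕ → ℕ
a n = a-acc n (<-wellFounded n)

a-acc-irrelevant : ∀ n (p q : Acc _<_ n) → a-acc n p ≡ a-acc n q
a-acc-irrelevant 0             _        _         = refl
a-acc-irrelevant 1             _        _         = refl
a-acc-irrelevant (suc (suc m)) (acc rs) (acc rs′) with parity m
... | 0ℙ = a-acc-irrelevant ⌊ suc (suc m) /2⌋ (rs (⌊n/2⌋<n (suc m))) (rs′ (⌊n/2⌋<n (suc m)))
... | 1ℙ = cong₂ _+_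
             (a-acc-irrelevant ⌊ suc (suc m) /2⌋ (rs (⌊n/2⌋<n (suc m))) (rs′ (⌊n/2⌋<n (suc m))))
             (a-acc-irrelevant ⌈ suc (suc m) /2⌉ (rs (⌈n/2⌉<n m)) (rs′ (⌈n/2⌉<n m)))

a-floor : ∀ n → parity n ≡ 0ℙ → a n ≡ a ⌊ n /2⌋
a-floor 0             _ = refl
a-floor (suc (suc m)) e = go (<-wellFounded (suc (suc m)))
  where
  go : ∀ p → a-acc (suc (suc m)) p ≡ a ⌊ suc (suc m) /2⌋
  go (acc rs) with 0ℙ ← parity m =
    a-acc-irrelevant ⌊ suc (suc m) /2⌋ (rs (⌊n/2⌋<n (suc m))) (<-wellFounded _)

a-floor+ceil : ∀ n → parity n ≡ 1ℙ → a n ≡ a ⌊ n /2⌋ + a ⌈ n /2⌉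
a-floor+ceil 1             _ = refl
a-floor+ceil (suc (suc m)) e = go (<-wellFounded (suc (suc m)))
  where
  go : ∀ p → a-acc (suc (suc m)) p ≡ a ⌊ suc (suc m) /2⌋ + a ⌈ suc (suc m) /2⌉
  go (acc rs) with 1ℙ ← parity m = cong₂ _+_
    (a-acc-irrelevant ⌊ suc (suc m) /2⌋ (rs (⌊n/2⌋<n (suc m))) (<-wellFounded _))
    (a-acc-irrelevant ⌈ suc (suc m) /2⌉ (rs (⌈n/2⌉<n m)) (<-wellFounded _))

2*suc : ∀ n → 2 * suc n ≡ suc (suc (2 * n))
2*suc n = cong suc (+-suc n (n + 0))

parity-2* : ∀ n → parity (2 * n) ≡ 0ℙ
parity-2* zero    = refl
parity-2* (suc n) = trans (cong parity (2*suc n)) (parity-2* n)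

parity-1+2* : ∀ n → parity (suc (2 * n)) ≡ 1ℙ
parity-1+2* zero    = refl
parity-1+2* (suc n) = trans (cong (λ k → parity (suc k)) (2*suc n)) (parity-1+2* n)

⌊2*n/2⌋ : ∀ n → ⌊ 2 * n /2⌋ ≡ n
⌊2*n/2⌋ zero    = refl
⌊2*n/2⌋ (suc n) = trans (cong ⌊_/2⌋ (2*suc n)) (cong suc (⌊2*n/2⌋ n))

⌊1+2*n/2⌋ : ∀ n → ⌊ suc (2 * n) /2⌋ ≡ n
⌊1+2*n/2⌋ zero    = refl
⌊1+2*n/2⌋ (suc n) = trans (cong ⌈_/2⌉ (2*suc n)) (cong suc (⌊1+2*n/2⌋ n))

a-even : ∀ n → a (2 * n) ≡ a n
a-even n = trans (a-floor (2 * n) (parity-2* n)) (cong a (⌊2*n/2⌋ n))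

a-odd : ∀ n → a (suc (2 * n)) ≡ a n + a (suc n)
a-odd n = trans (a-floor+ceil (suc (2 * n)) (parity-1+2* n))
                (cong₂ _+_ (cong a (⌊1+2*n/2⌋ n)) (cong (λ k → a (suc k)) (⌊2*n/2⌋ n)))

s : ℕ → ℕ
s n = a (suc n)

R : Pred ℕ 0ℓ
R v = ∀ i → i < v → s i < s v

-- Binary strings are written most significant bit first, whereas
-- fromDigits reads the least significant digit first.

BinaryString : Set
BinaryString = List Bit

[_]₂ : BinaryString → ℕ
[ x ]₂ = fromDigits (reverse x)

infixr 8 _^_

_^_ : BinaryString → ℕ → BinaryString
x ^ i = concat (replicate i x)

-- The number 0 is represented by the empty string.

_IsBinaryRepOf_ : BinaryString → ℕ → Set
x IsBinaryRepOf v = head x ≢ just 0b × [ x ]₂ ≡ v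

HasBinaryLength : ℕ → ℕ → Set
HasBinaryLength ℓ v = ∃[ x ] (x IsBinaryRepOf v × length x ≡ ℓ)

BinaryBeginsWith : BinaryString → ℕ → Set
BinaryBeginsWith p v = ∃[ x ] (x IsBinaryRepOf v × Prefix _≡_ p x)

R-ofLength : ℕ → Pred ℕ 0ℓ
R-ofLength ℓ v = v ∈ R × HasBinaryLength ℓ v

{-# OPTIONS --safe #-}

-- If i + j = 2^k then a(m 2^k + j) = a(m) a(i) + a(m+1) a(j).  With m = 1 this
-- yields the classical bounds a(j) ≤ F(k+1) and a(i) + a(j) ≤ F(k+2), so that
-- F(2n+4) is the maximum of s below 2^(2n+3), and it is attained there.  With
-- m = 8 and k = 2n it yields, for j = u + 1, s(8·4^n + u) = 3p + q where
-- p = a(j) ≤ F(2n+1) and q = a(i) + a(j) ≤ F(2n+2).  Both bounds are equalities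
-- at u = [(10)^n]₂, where s exceeds F(2n+4).  For smaller u one has
-- 3p + q ≤ F(2n+4), by induction along the map (p , q) ↦ (p + q , p + 2q) that
-- corresponds to prepending the digits 10.

module Submission where

open import Defs
open import Data.Digit using (Bit; 0b; 1b; fromDigits)
open import Data.Fin.Base using (toℕ; zero; suc)
open import Data.List.Base using ([]; _∷_; _++_; [_]; length; reverse)
open import Data.List.Properties using (unfold-reverse; length-reverse)
open import Data.List.Relation.Binary.Prefix.Heterogeneous using ([]; _∷_)
open import Data.Nat.Base using (ℕ; zero; suc; _+_; _*_; _∸_; _≤_; _<_; z≤n; z<s) renaming (_^_ to _↑_)
open import Data.Nat.Properties
open import Data.Nat.Tactic.RingSolver using (solve-∀)
open import Data.Product.Base using (_×_; _,_; proj₁; proj₂; ∃-syntax)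
open import Data.Sum.Base using (_⊎_; inj₁; inj₂)
open import Relation.Binary.PropositionalEquality using (_≡_; refl; sym; trans; cong; cong₂; subst; subst₂; module ≡-Reasoning)
open import Relation.Nullary.Negation using (contradiction)
open import Relation.Unary using (_∈_)

-- Stern's sequence on dyadic intervals

even-or-odd : ∀ n → ∃[ h ] (n ≡ 2 * h ⊎ n ≡ suc (2 * h))
even-or-odd zero = 0 , inj₁ refl
even-or-odd (suc n) with even-or-odd n
... | h , inj₁ e = h , inj₂ (cong suc e)
... | h , inj₂ e = suc h , inj₁ (trans (cong suc e) (sym (2*suc h)))

-- Induction on `k` by halving. For odd `i` and `j`, `a-odd` produces two consecutive indices, whose
-- offsets `h` and `h + 1` pair with `g + 1` and `g`; both pairs sum to 2^k.
a-interpolation : ∀ k m i j → i + j ≡ 2 ↑ k →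
                  a (m * 2 ↑ k + j) ≡ a m * a i + a (suc m) * a j
a-interpolation zero m 0 1 _ = trans (cong a (index m)) (value (a m) (a (suc m)))
  where
  index : ∀ m → m * 1 + 1 ≡ suc m
  index = solve-∀
  value : ∀ x y → y ≡ x * 0 + y * 1
  value = solve-∀
a-interpolation zero m 1 0 _ = trans (cong a (index m)) (value (a m) (a (suc m)))
  where
  index : ∀ m → m * 1 + 0 ≡ m
  index = solve-∀
  value : ∀ x y → x ≡ x * 1 + y * 0
  value = solve-∀
a-interpolation zero m 0 (suc (suc _)) ()
a-interpolation zero m 1 (suc _) ()
a-interpolation zero m (suc (suc _)) _ ()
a-interpolation (suc k) m i j e with even-or-odd i | even-or-odd j
... | g , inj₁ refl | h , inj₁ refl = begin
  a (m * (2 * 2 ↑ k) + 2 * h)              ≡⟨ cong a (double m (2 ↑ k) h) ⟩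
  a (2 * (m * 2 ↑ k + h))                  ≡⟨ a-even (m * 2 ↑ k + h) ⟩
  a (m * 2 ↑ k + h)                        ≡⟨ a-interpolation k m g h e′ ⟩
  a m * a g + a (suc m) * a h              ≡⟨ cong₂ (λ x y → a m * x + a (suc m) * y) (a-even g) (a-even h) ⟨
  a m * a (2 * g) + a (suc m) * a (2 * h)  ∎
  where
  open ≡-Reasoning
  double : ∀ x y z → x * (2 * y) + 2 * z ≡ 2 * (x * y + z)
  double = solve-∀
  e′ : g + h ≡ 2 ↑ k
  e′ = *-cancelˡ-≡ (g + h) (2 ↑ k) 2 (trans (*-distribˡ-+ 2 g h) e)
-- A sum of mixed parity is odd and cannot be 2^(k+1).
... | g , inj₁ refl | h , inj₂ refl =
  contradiction (sym (trans (odd g h) e)) (even≢odd (2 ↑ k) (g + h))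
  where
  odd : ∀ x y → suc (2 * (x + y)) ≡ 2 * x + suc (2 * y)
  odd = solve-∀
... | g , inj₂ refl | h , inj₁ refl =
  contradiction (sym (trans (odd g h) e)) (even≢odd (2 ↑ k) (g + h))
  where
  odd : ∀ x y → suc (2 * (x + y)) ≡ suc (2 * x) + 2 * y
  odd = solve-∀
... | g , inj₂ refl | h , inj₂ refl = begin
  a (m * (2 * 2 ↑ k) + suc (2 * h))        ≡⟨ cong a (double m (2 ↑ k) h) ⟩
  a (suc (2 * M))                          ≡⟨ a-odd M ⟩
  a M + a (suc M)                          ≡⟨ cong (λ x → a M + a x) (+-suc (m * 2 ↑ k) h) ⟨
  a M + a (m * 2 ↑ k + suc h)              ≡⟨ cong₂ _+_ (a-interpolation k m (suc g) h e′)
                                                        (a-interpolation k m g (suc h) (trans (+-suc g h) e′)) ⟩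
  a m * a (suc g) + a (suc m) * a h
    + (a m * a g + a (suc m) * a (suc h))  ≡⟨ rearrange (a m) (a (suc m)) (a g) (a (suc g)) (a h) (a (suc h)) ⟩
  a m * (a g + a (suc g)) + a (suc m) * (a h + a (suc h))
                                           ≡⟨ cong₂ (λ x y → a m * x + a (suc m) * y) (a-odd g) (a-odd h) ⟨
  a m * a (suc (2 * g)) + a (suc m) * a (suc (2 * h)) ∎
  where
  open ≡-Reasoning
  M = m * 2 ↑ k + h
  double : ∀ x y z → x * (2 * y) + suc (2 * z) ≡ suc (2 * (x * y + z))
  double = solve-∀
  rearrange : ∀ x y g g′ h h′ → x * g′ + y * h + (x * g + y * h′) ≡ x * (g + g′) + y * (h + h′)
  rearrange = solve-∀
  odd+odd : ∀ x y → 2 * (suc x + y) ≡ suc (2 * x) + suc (2 * y)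
  odd+odd = solve-∀
  e′ : suc g + h ≡ 2 ↑ k
  e′ = *-cancelˡ-≡ (suc g + h) (2 ↑ k) 2 (trans (odd+odd g h) e)

a-2^k+j : ∀ k i j → i + j ≡ 2 ↑ k → a (2 ↑ k + j) ≡ a i + a j
a-2^k+j k i j e = begin
  a (2 ↑ k + j)           ≡⟨ cong (λ x → a (x + j)) (*-identityˡ (2 ↑ k)) ⟨
  a (1 * 2 ↑ k + j)       ≡⟨ a-interpolation k 1 i j e ⟩
  1 * a i + 1 * a j       ≡⟨ cong₂ _+_ (*-identityˡ (a i)) (*-identityˡ (a j)) ⟩
  a i + a j               ∎
  where open ≡-Reasoning

-- The right side of `a-2^k+j` is symmetric in `i` and `j`: the sequence is a palindrome between 2^k
-- and 2^(k+1).
a-2^k+i : ∀ k i j → i + j ≡ 2 ↑ k → a (2 ↑ k + i) ≡ a i + a j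
a-2^k+i k i j e = trans (a-2^k+j k j i (trans (+-comm j i) e)) (+-comm (a j) (a i))

-- The coefficients are a(8) = 1 and a(9) = 4, and the shift s(n) = a(n+1) makes the offset `suc u`.
-- The grouping 3p + q lets the bounds on p and on q be applied separately and attained together.
s-1000 : ∀ k i u → i + suc u ≡ 2 ↑ k →
         s (8 * 2 ↑ k + u) ≡ 3 * a (suc u) + (a i + a (suc u))
s-1000 k i u e = begin
  a (suc (8 * 2 ↑ k + u))            ≡⟨ cong a (+-suc (8 * 2 ↑ k) u) ⟨
  a (8 * 2 ↑ k + suc u)              ≡⟨ a-interpolation k 8 i (suc u) e ⟩
  1 * a i + 4 * a (suc u)            ≡⟨ rearrange (a i) (a (suc u)) ⟩
  3 * a (suc u) + (a i + a (suc u))  ∎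
  where
  open ≡-Reasoning
  rearrange : ∀ x y → 1 * x + 4 * y ≡ 3 * y + (x + y)
  rearrange = solve-∀

-- Fibonacci bounds

F : ℕ → ℕ
F 0             = 0
F 1             = 1
F (suc (suc n)) = F (suc n) + F n

F-step-≤ : ∀ n → F n ≤ F (suc n)
F-step-≤ zero    = z≤n
F-step-≤ (suc n) = m≤m+n (F (suc n)) (F n)

F-suc>0 : ∀ n → 0 < F (suc n)
F-suc>0 zero    = z<s
F-suc>0 (suc n) = ≤-trans (F-suc>0 n) (F-step-≤ (suc n))

-- Restricted to even indices because F(1) = F(2). This gap is what lifts `peak n` above all earlier
-- values.
F-even-step-< : ∀ n → F (2 * n) < F (suc (2 * n))
F-even-step-< zero    = z<s
F-even-step-< (suc n) rewrite +-suc n (n + 0) = m<m+n (F (2 + 2 * n)) (F-suc>0 (2 * n))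

-- Strips 2^k from whichever of `i` and `j` reaches it; the remaining pair lies one level down,
-- where `a-2^k+j` and `a-2^k+i` apply.
split-2^ : ∀ k i j → i + j ≡ 2 ↑ suc k →
           (∃[ j′ ] (j ≡ 2 ↑ k + j′ × i + j′ ≡ 2 ↑ k)) ⊎
           (∃[ i′ ] (i ≡ 2 ↑ k + i′ × i′ + j ≡ 2 ↑ k))
split-2^ k i j e with ≤-total (2 ↑ k) j
... | inj₁ P≤j = let j′ , P+j′≡j = m≤n⇒∃[o]m+o≡n P≤j in
  inj₁ (j′ , sym P+j′≡j , +-cancelˡ-≡ (2 ↑ k) (i + j′) (2 ↑ k) (begin
    2 ↑ k + (i + j′)     ≡⟨ swap (2 ↑ k) i j′ ⟩
    i + (2 ↑ k + j′)     ≡⟨ cong (i +_) P+j′≡j ⟩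
    i + j                ≡⟨ e ⟩
    2 * 2 ↑ k            ≡⟨ cong (2 ↑ k +_) (+-identityʳ (2 ↑ k)) ⟩
    2 ↑ k + 2 ↑ k        ∎))
  where
  open ≡-Reasoning
  swap : ∀ x y z → x + (y + z) ≡ y + (x + z)
  swap = solve-∀
... | inj₂ j≤P = let i′ , j+i′≡P = m≤n⇒∃[o]m+o≡n j≤P in
  inj₂ (i′ , +-cancelʳ-≡ j i (2 ↑ k + i′) (begin
    i + j                ≡⟨ e ⟩
    2 * 2 ↑ k            ≡⟨ cong (2 ↑ k +_) (+-identityʳ (2 ↑ k)) ⟩
    2 ↑ k + 2 ↑ k        ≡⟨ cong (2 ↑ k +_) (trans (sym j+i′≡P) (+-comm j i′)) ⟩
    2 ↑ k + (i′ + j)     ≡⟨ +-assoc (2 ↑ k) i′ j ⟨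
    2 ↑ k + i′ + j       ∎) , trans (+-comm i′ j) j+i′≡P)
  where open ≡-Reasoning

FibBounded : ℕ → ℕ → ℕ → Set
FibBounded k x y = x ≤ F (suc k) × y ≤ F (suc k) × x + y ≤ F (2 + k)

FibBounded-sym : ∀ {k x y} → FibBounded k x y → FibBounded k y x
FibBounded-sym {k} {x} {y} (p , q , r) = q , p , subst (_≤ F (2 + k)) (+-comm x y) r

-- This is the effect on values of adding 2^k to one member of a pair. The old bound on the sum
-- becomes the bound on the new entry, which is why the three bounds are carried jointly.
FibBounded-step : ∀ {k x y} → FibBounded k x y → FibBounded (suc k) x (x + y)
FibBounded-step {k} {x} {y} (p , q , r) =
  ≤-trans p (F-step-≤ (suc k)) , r ,
  subst (x + (x + y) ≤_) (+-comm (F (suc k)) (F (2 + k))) (+-mono-≤ p r)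

a-fibBounded : ∀ k i j → i + j ≡ 2 ↑ k → FibBounded k (a i) (a j)
a-fibBounded zero 0 1 _ = z≤n , ≤-refl , ≤-refl
a-fibBounded zero 1 0 _ = ≤-refl , z≤n , ≤-refl
a-fibBounded zero 0 (suc (suc _)) ()
a-fibBounded zero 1 (suc _) ()
a-fibBounded zero (suc (suc _)) _ ()
a-fibBounded (suc k) i j e with split-2^ k i j e
... | inj₁ (j′ , refl , e′) rewrite a-2^k+j k i j′ e′ =
  FibBounded-step {k} (a-fibBounded k i j′ e′)
... | inj₂ (i′ , refl , e′) rewrite a-2^k+i k i′ j e′ | +-comm (a i′) (a j) =
  FibBounded-sym {suc k} (FibBounded-step {k} (FibBounded-sym {k} (a-fibBounded k i′ j e′)))

a≤F : ∀ k {z} → z ≤ 2 ↑ k → a z ≤ F (suc k)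
a≤F k {z} z≤ = proj₁ (proj₂ (a-fibBounded k (2 ↑ k ∸ z) z (m∸n+n≡m z≤)))

-- The alternating indices

-- alt n = [(10)^n]₂

alt : ℕ → ℕ
alt zero    = 0
alt (suc n) = 2 ↑ suc (2 * n) + alt n

-- Prepending 10 sends the pair `i`, `suc (alt n)` to `P + i`, `suc (2 * P + alt n)` with P = 4^n.
-- If p = a(j) and q = a(i) + a(j) belong to the old pair, the new pair has values q and q + p, the
-- next two Fibonacci numbers.
alt-extremal : ∀ n → ∃[ i ] (i + suc (alt n) ≡ 2 ↑ (2 * n)
                           × a (suc (alt n)) ≡ F (suc (2 * n))
                           × a i + a (suc (alt n)) ≡ F (2 + 2 * n))
alt-extremal zero    = 0 , refl , refl , refl
alt-extremal (suc n) rewrite +-suc n (n + 0) with alt-extremal n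
... | i , e , ap , aq = P + i , sum , aj , trans (cong₂ _+_ ai aj) (+-comm (F (2 + 2 * n)) (F (3 + 2 * n)))
  where
  P = 2 ↑ (2 * n)
  t = alt n
  rearrange : ∀ x y z → x + y + suc (2 * x + z) ≡ 2 * x + (x + (y + suc z))
  rearrange = solve-∀
  total : ∀ x → 2 * x + (x + x) ≡ 2 * (2 * x)
  total = solve-∀
  sum : P + i + suc (2 * P + t) ≡ 2 * (2 * P)
  sum = trans (rearrange P i t) (trans (cong (λ z → 2 * P + (P + z)) e) (total P))
  ai : a (P + i) ≡ F (2 + 2 * n)
  ai = trans (a-2^k+i (2 * n) i (suc t) e) aq
  e′ : P + i + suc t ≡ 2 * P
  e′ = trans (+-assoc P i (suc t)) (trans (cong (P +_) e) (cong (P +_) (sym (+-identityʳ P))))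
  aj : a (suc (2 * P + t)) ≡ F (3 + 2 * n)
  aj = trans (cong a (sym (+-suc (2 * P) t)))
       (trans (a-2^k+j (suc (2 * n)) (P + i) (suc t) e′) (cong₂ _+_ ai ap))

alt<2^2n : ∀ n → alt n < 2 ↑ (2 * n)
alt<2^2n n = let i , e , _ = alt-extremal n in subst (suc (alt n) ≤_) e (m≤n+m (suc (alt n)) i)

-- Bounding 3p + q for indices up to `alt n`

-- The third inequality is the one of interest.  With d = O - p and
-- e = (O + E) - q the first two read d + 2e ≥ O - E and 2d + 3e ≥ E; they
-- are what makes the induction close.
Slack : (E O p q : ℕ) → Set
Slack E O p q = p + 2 * q ≤ 3 * E + 2 * O
              × 2 * p + 3 * q ≤ 2 * E + 5 * O
              × 3 * p + q ≤ 2 * E + 3 * O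

-- Writing A and B for the first two inequalities, the new ones are A + B, A + 2B and A + B +
-- (`p ≤ O`).
Slack-step : ∀ {E O p q} → p ≤ O → Slack E O p q →
             Slack (O + E) (O + E + O) (p + q) (p + 2 * q)
Slack-step {E} {O} {p} {q} p≤O (A , B , _) =
  subst₂ _≤_ (l₁ p q) (r₁ E O) (+-mono-≤ A B) ,
  subst₂ _≤_ (l₂ p q) (r₂ E O) (+-mono-≤ A (+-mono-≤ B B)) ,
  subst₂ _≤_ (l₃ p q) (r₃ E O) (+-mono-≤ p≤O (+-mono-≤ A B))
  where
  l₁ : ∀ p q → (p + 2 * q) + (2 * p + 3 * q) ≡ (p + q) + 2 * (p + 2 * q)
  l₁ = solve-∀
  r₁ : ∀ E O → (3 * E + 2 * O) + (2 * E + 5 * O) ≡ 3 * (O + E) + 2 * (O + E + O)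
  r₁ = solve-∀
  l₂ : ∀ p q → (p + 2 * q) + ((2 * p + 3 * q) + (2 * p + 3 * q)) ≡ 2 * (p + q) + 3 * (p + 2 * q)
  l₂ = solve-∀
  r₂ : ∀ E O → (3 * E + 2 * O) + ((2 * E + 5 * O) + (2 * E + 5 * O)) ≡ 2 * (O + E) + 5 * (O + E + O)
  r₂ = solve-∀
  l₃ : ∀ p q → p + ((p + 2 * q) + (2 * p + 3 * q)) ≡ 3 * (p + q) + (p + 2 * q)
  l₃ = solve-∀
  r₃ : ∀ E O → O + ((3 * E + 2 * O) + (2 * E + 5 * O)) ≡ 2 * (O + E) + 3 * (O + E + O)
  r₃ = solve-∀

-- For `j` in the lower half, p obeys the bound F(2n+2) of one level down, while q keeps the general
-- bound F(2n+4). The first inequality then adds up exactly, the second uses `E ≤ O`, and the third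
-- has `2 * O` to spare.
Slack-lowerHalf : ∀ {E O p q} → E ≤ O → p ≤ O + E → q ≤ O + E + O + (O + E) →
                  Slack (O + E) (O + E + O) p q
Slack-lowerHalf {E} {O} {p} {q} E≤O p≤ q≤ =
  subst (p + 2 * q ≤_) (r₁ E O) (+-mono-≤ p≤ (*-monoʳ-≤ 2 q≤)) ,
  (begin
    2 * p + 3 * q                                   ≤⟨ +-mono-≤ (*-monoʳ-≤ 2 p≤) (*-monoʳ-≤ 3 q≤) ⟩
    2 * (O + E) + 3 * (O + E + O + (O + E))         ≡⟨ r₂ E O ⟩
    7 * E + 11 * O + E                              ≤⟨ +-monoʳ-≤ (7 * E + 11 * O) E≤O ⟩
    7 * E + 11 * O + O                              ≡⟨ r₂′ E O ⟩
    2 * (O + E) + 5 * (O + E + O)                   ∎) ,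
  (begin
    3 * p + q                                       ≤⟨ +-mono-≤ (*-monoʳ-≤ 3 p≤) q≤ ⟩
    3 * (O + E) + (O + E + O + (O + E))             ≤⟨ m≤m+n _ (2 * O) ⟩
    3 * (O + E) + (O + E + O + (O + E)) + 2 * O     ≡⟨ r₃ E O ⟩
    2 * (O + E) + 3 * (O + E + O)                   ∎)
  where
  open ≤-Reasoning
  r₁ : ∀ E O → O + E + 2 * (O + E + O + (O + E)) ≡ 3 * (O + E) + 2 * (O + E + O)
  r₁ = solve-∀
  r₂ : ∀ E O → 2 * (O + E) + 3 * (O + E + O + (O + E)) ≡ 7 * E + 11 * O + E
  r₂ = solve-∀
  r₂′ : ∀ E O → 7 * E + 11 * O + O ≡ 2 * (O + E) + 5 * (O + E + O)
  r₂′ = solve-∀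
  r₃ : ∀ E O → 3 * (O + E) + (O + E + O + (O + E)) + 2 * O ≡ 2 * (O + E) + 3 * (O + E + O)
  r₃ = solve-∀

a-slack : ∀ n i j → i + j ≡ 2 ↑ (2 * n) → j ≤ alt n →
          Slack (F (2 * n)) (F (suc (2 * n))) (a j) (a i + a j)
-- The only pair is `i` = 1, `j` = 0, so p = 0 and q = 1.
a-slack zero i 0 e z≤n with refl ← trans (sym (+-identityʳ i)) e =
  ≤-refl , m≤m+n 3 2 , m≤m+n 1 2
a-slack (suc n) i j e j≤alt rewrite +-suc n (n + 0) with split-2^ (suc (2 * n)) i j e
-- Here `j` is at most 2^(2n+1), and the Fibonacci bounds suffice.
... | inj₂ (i′ , _ , e′) =
  Slack-lowerHalf (F-step-≤ (2 * n))
    (proj₁ (proj₂ (a-fibBounded (suc (2 * n)) i′ j e′)))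
    (proj₂ (proj₂ (a-fibBounded (2 + 2 * n) i j e)))
... | inj₁ (j₁ , refl , e₁) with split-2^ (2 * n) i j₁ e₁
-- Here `j` would be at least 2^(2n+1) + 2^(2n), beyond `alt (suc n)`.
...   | inj₁ (_ , refl , _) =
  contradiction (+-cancelˡ-≤ (2 ↑ suc (2 * n)) _ _ j≤alt)
                (<⇒≱ (<-≤-trans (alt<2^2n n) (m≤m+n _ _)))
-- Here `j` begins with 10. Removing these digits leaves `j₁` at most `alt n`, so the induction
-- applies.
...   | inj₂ (i₁ , refl , e₂) =
  subst₂ (Slack (F (2 + 2 * n)) (F (3 + 2 * n))) (sym p≡) (sym q≡)
    (Slack-step (proj₁ (proj₂ (a-fibBounded (2 * n) i₁ j₁ e₂)))
                (a-slack n i₁ j₁ e₂ (+-cancelˡ-≤ (2 ↑ suc (2 * n)) _ _ j≤alt)))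
  where
  p₁ = a j₁
  q₁ = a i₁ + a j₁
  ai : a (2 ↑ (2 * n) + i₁) ≡ q₁
  ai = a-2^k+i (2 * n) i₁ j₁ e₂
  p≡ : a (2 ↑ suc (2 * n) + j₁) ≡ p₁ + q₁
  p≡ = trans (a-2^k+j (suc (2 * n)) _ j₁ e₁) (trans (cong (_+ p₁) ai) (+-comm q₁ p₁))
  rearrange : ∀ p q → q + (p + q) ≡ p + 2 * q
  rearrange = solve-∀
  q≡ : a (2 ↑ (2 * n) + i₁) + a (2 ↑ suc (2 * n) + j₁) ≡ p₁ + 2 * q₁
  q≡ = trans (cong₂ _+_ ai p≡) (rearrange p₁ q₁)

-- Values of s below 9·4^n

2^3+k : ∀ k → 2 ↑ (3 + k) ≡ 8 * 2 ↑ k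
2^3+k = ^-distribˡ-+-* 2 3

peak : ℕ → ℕ
peak n = 3 * F (suc (2 * n)) + F (2 + 2 * n)

-- The two sides share F(2n) + 3 F(2n+1); what remains is F(2n) < F(2n+1).
F<peak : ∀ n → F (4 + 2 * n) < peak n
F<peak n = subst₂ _<_ (l (F (2 * n)) (F (suc (2 * n)))) (r (F (2 * n)) (F (suc (2 * n))))
             (+-monoʳ-< (F (2 * n) + 3 * F (suc (2 * n))) (F-even-step-< n))
  where
  l : ∀ E O → E + 3 * O + E ≡ O + E + O + (O + E)
  l = solve-∀
  r : ∀ E O → E + 3 * O + O ≡ 3 * O + (O + E)
  r = solve-∀

s-below : ∀ n {i} → i < 8 * 2 ↑ (2 * n) → s i ≤ F (4 + 2 * n)
s-below n i< = a≤F (3 + 2 * n) (≤-trans i< (≤-reflexive (sym (2^3+k (2 * n)))))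

s-below-attained : ∀ n → ∃[ i ] (i < 8 * 2 ↑ (2 * n) × s i ≡ F (4 + 2 * n))
s-below-attained n with alt-extremal (suc n) | alt<2^2n (suc n)
... | ext | lt rewrite +-suc n (n + 0) = let i , e , _ , aq = ext in
  -- This index is [1(10)^(n+1)]₂.
  4P + alt (suc n) ,
  subst (4P + alt (suc n) <_) (total (2 ↑ (2 * n))) (+-monoʳ-< 4P lt) ,
  trans (cong a (sym (+-suc 4P (alt (suc n))))) (trans (a-2^k+j (2 + 2 * n) i _ e) aq)
  where
  4P = 2 ↑ (2 + 2 * n)
  total : ∀ x → 2 * (2 * x) + 2 * (2 * x) ≡ 8 * x
  total = solve-∀

s-alt : ∀ n → s (8 * 2 ↑ (2 * n) + alt n) ≡ peak n
s-alt n = let i , e , ap , aq = alt-extremal n in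
  trans (s-1000 (2 * n) i (alt n) e) (cong₂ (λ x y → 3 * x + y) ap aq)

s-1000≤peak : ∀ n {u} → u < 2 ↑ (2 * n) → s (8 * 2 ↑ (2 * n) + u) ≤ peak n
s-1000≤peak n {u} u< =
  let e           = m∸n+n≡m u<
      _ , p≤ , q≤ = a-fibBounded (2 * n) _ (suc u) e
  in ≤-trans (≤-reflexive (s-1000 (2 * n) _ u e)) (+-mono-≤ (*-monoʳ-≤ 3 p≤) q≤)

-- Because `s` shifts by one, `u < alt n` is exactly the bound on `suc u` that `a-slack` asks for;
-- the right side of its third inequality is F(2n+4).
s-1000-before-alt : ∀ n {u} → u < alt n → s (8 * 2 ↑ (2 * n) + u) ≤ F (4 + 2 * n)
s-1000-before-alt n {u} u<alt =
  let e         = m∸n+n≡m (≤-trans u<alt (<⇒≤ (alt<2^2n n)))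
      _ , _ , C = a-slack n _ (suc u) e u<alt
  in ≤-trans (≤-reflexive (s-1000 (2 * n) _ u e))
             (≤-trans C (≤-reflexive (r (F (2 * n)) (F (suc (2 * n))))))
  where
  r : ∀ E O → 2 * E + 3 * O ≡ O + E + O + (O + E)
  r = solve-∀

s-before-alt : ∀ n {v} → v < 8 * 2 ↑ (2 * n) + alt n → s v ≤ F (4 + 2 * n)
s-before-alt n {v} v< with ≤-<-connex (8 * 2 ↑ (2 * n)) v
... | inj₂ v<8P = s-below n v<8P
... | inj₁ 8P≤v with u , refl ← m≤n⇒∃[o]m+o≡n 8P≤v =
  s-1000-before-alt n (+-cancelˡ-< (8 * 2 ↑ (2 * n)) _ _ v<)

alt∈R : ∀ n → (8 * 2 ↑ (2 * n) + alt n) ∈ R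
alt∈R n i i< = ≤-<-trans (s-before-alt n i<) (<-≤-trans (F<peak n) (≤-reflexive (sym (s-alt n))))

-- A record-setter from 8·4^n on must exceed F(2n+4), which is attained earlier; no index before
-- 8·4^n + `alt n` does.
R-from-2^3+2n : ∀ n {v} → v ∈ R → 8 * 2 ↑ (2 * n) ≤ v → 8 * 2 ↑ (2 * n) + alt n ≤ v
R-from-2^3+2n n {v} v∈R 8P≤v with ≤-<-connex (8 * 2 ↑ (2 * n) + alt n) v
... | inj₁ w≤v = w≤v
... | inj₂ v<w = let i , i<8P , si≡ = s-below-attained n in
  contradiction (s-before-alt n v<w)
    (<⇒≱ (≤-<-trans (≤-reflexive (sym si≡)) (v∈R i (<-≤-trans i<8P 8P≤v))))

R-1000-unique : ∀ n {v} → v ∈ R → 8 * 2 ↑ (2 * n) ≤ v → v < 9 * 2 ↑ (2 * n) →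
                v ≡ 8 * 2 ↑ (2 * n) + alt n
R-1000-unique n v∈R 8P≤v v<9P with m≤n⇒m<n∨m≡n (R-from-2^3+2n n v∈R 8P≤v)
... | inj₂ w≡v = sym w≡v
-- Later indices of the block 1000 have values at most `peak n`, which is already reached at
-- `alt n`.
... | inj₁ w<v with u , refl ← m≤n⇒∃[o]m+o≡n 8P≤v =
  contradiction (s-1000≤peak n (+-cancelˡ-< (8 * P) _ _ (<-≤-trans v<9P (≤-reflexive (+-comm P (8 * P))))))
    (<⇒≱ (≤-<-trans (≤-reflexive (sym (s-alt n))) (v∈R _ w<v)))
  where P = 2 ↑ (2 * n)

-- Binary representations

-- After `reverse` the most significant bit is the last digit, so its weight has to be read off at
-- the end.
fromDigits-∷ʳ : ∀ (x : BinaryString) (b : Bit) →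
                fromDigits (x ++ [ b ]) ≡ toℕ b * 2 ↑ length x + fromDigits x
fromDigits-∷ʳ []      b = base (toℕ b)
  where
  base : ∀ b → b + 0 ≡ b * 1 + 0
  base = solve-∀
fromDigits-∷ʳ (d ∷ x) b =
  trans (cong (λ z → toℕ d + z * 2) (fromDigits-∷ʳ x b))
        (rearrange (toℕ d) (toℕ b) (2 ↑ length x) (fromDigits x))
  where
  rearrange : ∀ d b p z → d + (b * p + z) * 2 ≡ b * (2 * p) + (d + z * 2)
  rearrange = solve-∀

[∷]₂ : ∀ b x → [ b ∷ x ]₂ ≡ toℕ b * 2 ↑ length x + [ x ]₂
[∷]₂ b x = begin
  fromDigits (reverse (b ∷ x))                  ≡⟨ cong fromDigits (unfold-reverse b x) ⟩
  fromDigits (reverse x ++ [ b ])               ≡⟨ fromDigits-∷ʳ (reverse x) b ⟩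
  toℕ b * 2 ↑ length (reverse x) + [ x ]₂       ≡⟨ cong (λ ℓ → toℕ b * 2 ↑ ℓ + [ x ]₂) (length-reverse x) ⟩
  toℕ b * 2 ↑ length x + [ x ]₂                 ∎
  where open ≡-Reasoning

[1∷]₂ : ∀ x → [ 1b ∷ x ]₂ ≡ 2 ↑ length x + [ x ]₂
[1∷]₂ x = trans ([∷]₂ 1b x) (cong (_+ [ x ]₂) (*-identityˡ (2 ↑ length x)))

[]₂<2^length : ∀ x → [ x ]₂ < 2 ↑ length x
[]₂<2^length []             = z<s
[]₂<2^length (zero ∷ x)     = subst (_< 2 ↑ suc (length x)) (sym ([∷]₂ 0b x))
  (<-≤-trans ([]₂<2^length x) (m≤m+n _ _))
[]₂<2^length (suc zero ∷ x) = subst (_< 2 ↑ suc (length x)) (sym ([1∷]₂ x))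
  (+-monoʳ-< (2 ↑ length x) (<-≤-trans ([]₂<2^length x) (≤-reflexive (sym (+-identityʳ _)))))

HasBinaryLength⇒bounds : ∀ {ℓ v} → HasBinaryLength (suc ℓ) v → 2 ↑ ℓ ≤ v × v < 2 ↑ suc ℓ
HasBinaryLength⇒bounds (zero ∷ x     , (h , _)    , _)    = contradiction refl h
HasBinaryLength⇒bounds (suc zero ∷ x , (_ , refl) , refl) =
  ≤-trans (m≤m+n _ _) (≤-reflexive (sym ([1∷]₂ x))) , []₂<2^length (1b ∷ x)

[1000++]₂ : ∀ x → [ 1b ∷ 0b ∷ 0b ∷ 0b ∷ x ]₂ ≡ 8 * 2 ↑ length x + [ x ]₂
[1000++]₂ x = trans ([1∷]₂ (0b ∷ 0b ∷ 0b ∷ x)) (cong₂ _+_ (2^3+k (length x))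
  (trans ([∷]₂ 0b (0b ∷ 0b ∷ x)) (trans ([∷]₂ 0b (0b ∷ x)) ([∷]₂ 0b x))))

-- The representation showing the prefix is not given to be the one showing the length, so the
-- number of digits after 1000 is bounded through the size of `v`.
BeginsWith1000⇒< : ∀ k {v} → BinaryBeginsWith (1b ∷ 0b ∷ 0b ∷ 0b ∷ []) v →
                   v < 2 ↑ (4 + k) → v < 9 * 2 ↑ k
BeginsWith1000⇒< k (_ ∷ _ ∷ _ ∷ _ ∷ x , (_ , refl) , refl ∷ refl ∷ refl ∷ refl ∷ []) v< =
  begin-strict
    [ 1b ∷ 0b ∷ 0b ∷ 0b ∷ x ]₂         ≡⟨ [1000++]₂ x ⟩
    8 * 2 ↑ length x + [ x ]₂          <⟨ +-monoʳ-< (8 * 2 ↑ length x) ([]₂<2^length x) ⟩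
    8 * 2 ↑ length x + 2 ↑ length x    ≡⟨ +-comm (8 * 2 ↑ length x) _ ⟩
    9 * 2 ↑ length x                   ≤⟨ *-monoʳ-≤ 9 (^-monoʳ-≤ 2 length≤k) ⟩
    9 * 2 ↑ k                          ∎
  where
  open ≤-Reasoning
  length≤k : length x ≤ k
  -- A longer tail would force `v` to be at least 2^(4+k).
  length≤k = ≮⇒≥ λ k<length → <⇒≱ v< (begin
    2 ↑ (4 + k)                        ≤⟨ ^-monoʳ-≤ 2 (+-monoʳ-≤ 3 k<length) ⟩
    2 ↑ (3 + length x)                 ≡⟨ 2^3+k (length x) ⟩
    8 * 2 ↑ length x                   ≤⟨ m≤m+n _ _ ⟩
    8 * 2 ↑ length x + [ x ]₂          ≡⟨ [1000++]₂ x ⟨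
    [ 1b ∷ 0b ∷ 0b ∷ 0b ∷ x ]₂         ∎)

length-10^ : ∀ n → length ((1b ∷ 0b ∷ []) ^ n) ≡ 2 * n
length-10^ zero    = refl
length-10^ (suc n) = trans (cong (2 +_) (length-10^ n)) (sym (2*suc n))

[10^]₂ : ∀ n → [ (1b ∷ 0b ∷ []) ^ n ]₂ ≡ alt n
[10^]₂ zero    = refl
[10^]₂ (suc n) = trans ([1∷]₂ (0b ∷ x)) (cong₂ _+_ (cong (λ ℓ → 2 ↑ suc ℓ) (length-10^ n))
                                                 (trans ([∷]₂ 0b x) ([10^]₂ n)))
  where x = (1b ∷ 0b ∷ []) ^ n

-- Record-setters of binary length 2n + 4

mainTheorem15 : (n : ℕ) →
    let 1000b = 1b ∷ 0b ∷ 0b ∷ 0b ∷ []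
        w     = [ 1000b ++ (1b ∷ 0b ∷ []) ^ n ]₂
    in  ((w ∈ R-ofLength (2 * n + 4) × BinaryBeginsWith 1000b w)
          × (∀ v → v ∈ R-ofLength (2 * n + 4) → BinaryBeginsWith 1000b v → v ≡ w))
        × (w ∈ R-ofLength (2 * n + 4)
          × (∀ v → v ∈ R-ofLength (2 * n + 4) → w ≤ v))
mainTheorem15 n = ((w∈ , x , rep , refl ∷ refl ∷ refl ∷ refl ∷ []) , unique) , (w∈ , least)
  where
  y = (1b ∷ 0b ∷ []) ^ n
  x = 1b ∷ 0b ∷ 0b ∷ 0b ∷ y
  w = [ x ]₂

  w≡ : w ≡ 8 * 2 ↑ (2 * n) + alt n
  w≡ = trans ([1000++]₂ y) (cong₂ (λ ℓ t → 8 * 2 ↑ ℓ + t) (length-10^ n) ([10^]₂ n))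

  rep : x IsBinaryRepOf w
  rep = (λ ()) , refl

  w∈ : w ∈ R-ofLength (2 * n + 4)
  w∈ = subst R (sym w≡) (alt∈R n) ,
       x , rep , trans (cong (4 +_) (length-10^ n)) (+-comm 4 (2 * n))

  bounds : ∀ {v} → HasBinaryLength (2 * n + 4) v → 8 * 2 ↑ (2 * n) ≤ v × v < 2 ↑ (4 + 2 * n)
  bounds {v} hasLength =
    let lower , upper = HasBinaryLength⇒bounds (subst (λ ℓ → HasBinaryLength ℓ v) (+-comm (2 * n) 4) hasLength)
    in ≤-trans (≤-reflexive (sym (2^3+k (2 * n)))) lower , upper

  unique : ∀ v → v ∈ R-ofLength (2 * n + 4) → BinaryBeginsWith (1b ∷ 0b ∷ 0b ∷ 0b ∷ []) v → v ≡ w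
  unique v (v∈R , hasLength) begins =
    let lower , upper = bounds hasLength
    in trans (R-1000-unique n v∈R lower (BeginsWith1000⇒< (2 * n) begins upper)) (sym w≡)

  least : ∀ v → v ∈ R-ofLength (2 * n + 4) → w ≤ v
  least v (v∈R , hasLength) =
    ≤-trans (≤-reflexive w≡) (R-from-2^3+2n n v∈R (proj₁ (bounds hasLength)))
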